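{- Let $\mathcal{E}=\{n\ge 1: e(n)=e(n+1)\}$. (1) The set $\mathcal{E}$ is infinite. If $m\in\mathcal{E}$, then $n=4m+1$ satisfies $e(n)=e(n+1)=e(n+2)$. Conversely, if $n\ge 1$ satisfies $e(n)=e(n+1)=e(n+2)$, then $n=4m+1$ for some integer $m\in\mathcal{E}$. (2) There is no integer $n\ge 1$ with $e(n)=e(n+1)=e(n+2)=e(n+3)$.
   Context: The Stern polynomials $B_n(t)\in\mathbb{Z}[t]$, $n\ge 0$, are defined by $B_0(t)=0$, $B_1(t)=1$, $B_{2n}(t)=tB_n(t)$ and $B_{2n+1}(t)=B_n(t)+B_{n+1}(t)$ for $n\ge 1$. For $n\ge 1$, $e(n)=\deg_t B_n(t)$. -}

module Defs where

open import Data.Integer.Base as ℤ using (ℤ; 0ℤ; 1ℤ)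
open import Data.Integer.Properties using () renaming (_≟_ to _≟ℤ_)
open import Data.List.Base using (List; []; _∷_)
open import Data.Maybe.Base using (Maybe; just; nothing; fromMaybe)
open import Data.Nat.Base
open import Data.Nat.Induction using (<-wellFounded)
open import Data.Nat.Properties
open import Data.Parity.Base using (Parity; 0ℙ; 1ℙ)
open import Data.Product.Base using (∃; _×_)
open import Induction.WellFounded using (Acc; acc)
open import Relation.Binary.PropositionalEquality
open import Relation.Nullary.Decidable.Core using (yes; no)
open import Relation.Unary using (Pred)
open import Level using (0ℓ)

-- Elements of ℤ[t] as coefficient lists, constant term first.  Trailing
-- zeros are allowed, so [] is only one of the representatives of 0.
Poly : Set
Poly = List ℤ

infixl 6 _⊕_

_⊕_ : Poly → Poly → Poly
[]      ⊕ q       = q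
(a ∷ p) ⊕ []      = a ∷ p
(a ∷ p) ⊕ (b ∷ q) = (a ℤ.+ b) ∷ (p ⊕ q)

t·_ : Poly → Poly
t· p = 0ℤ ∷ p

-- The largest index of a nonzero coefficient; nothing for the zero polynomial.
degree : Poly → Maybe ℕ
degree []      = nothing
degree (a ∷ p) with degree p
... | just d  = just (suc d)
... | nothing with a ≟ℤ 0ℤ
...   | yes _ = nothing
...   | no  _ = just 0

-- The recurrence is on ⌊n/2⌋ and ⌈n/2⌉, hence the accessibility argument;
-- B-even and B-odd below give it in the usual form.
B-acc : ∀ n → Acc _<_ n → Poly
B-acc 0                 _        = []
B-acc 1                 _        = 1ℤ ∷ []
B-acc n@(suc (suc k)) (acc rs) with parity n
... | 0ℙ = t· B-acc ⌊ n /2⌋ (rs (⌊n/2⌋<n (suc k)))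
... | 1ℙ = B-acc ⌊ n /2⌋ (rs (⌊n/2⌋<n (suc k))) ⊕ B-acc ⌈ n /2⌉ (rs (⌈n/2⌉<n k))

B : ℕ → Poly
B n = B-acc n (<-wellFounded n)

B-acc-irrelevant : ∀ n (a b : Acc _<_ n) → B-acc n a ≡ B-acc n b
B-acc-irrelevant 0               _        _        = refl
B-acc-irrelevant 1               _        _        = refl
B-acc-irrelevant n@(suc (suc k)) (acc rs) (acc ss) with parity n
... | 0ℙ = cong t·_ (B-acc-irrelevant ⌊ n /2⌋ _ _)
... | 1ℙ = cong₂ _⊕_ (B-acc-irrelevant ⌊ n /2⌋ _ _) (B-acc-irrelevant ⌈ n /2⌉ _ _)

private
  unfold-even : ∀ k → parity k ≡ 0ℙ → B (2 + k) ≡ t· B ⌊ 2 + k /2⌋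
  unfold-even k eq with <-wellFounded (2 + k)
  ... | acc rs with parity k | eq
  ...   | 0ℙ | refl = cong t·_ (B-acc-irrelevant ⌊ 2 + k /2⌋ _ _)

  unfold-odd : ∀ k → parity k ≡ 1ℙ → B (2 + k) ≡ B ⌊ 2 + k /2⌋ ⊕ B ⌈ 2 + k /2⌉
  unfold-odd k eq with <-wellFounded (2 + k)
  ... | acc rs with parity k | eq
  ...   | 1ℙ | refl = cong₂ _⊕_ (B-acc-irrelevant ⌊ 2 + k /2⌋ _ _)
                                (B-acc-irrelevant ⌈ 2 + k /2⌉ _ _)

  double-suc : ∀ n → 2 * suc n ≡ 2 + 2 * n
  double-suc n = *-suc 2 n

  parity-double : ∀ n → parity (2 * n) ≡ 0ℙ
  parity-double zero    = refl
  parity-double (suc n) = trans (cong parity (double-suc n)) (parity-double n)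

  parity-double+1 : ∀ n → parity (1 + 2 * n) ≡ 1ℙ
  parity-double+1 zero    = refl
  parity-double+1 (suc n) =
    trans (cong (λ m → parity (1 + m)) (double-suc n)) (parity-double+1 n)

  ⌊2n/2⌋ : ∀ n → ⌊ 2 * n /2⌋ ≡ n
  ⌊2n/2⌋ zero    = refl
  ⌊2n/2⌋ (suc n) = trans (cong ⌊_/2⌋ (double-suc n)) (cong suc (⌊2n/2⌋ n))

  ⌊1+2n/2⌋ : ∀ n → ⌊ 1 + 2 * n /2⌋ ≡ n
  ⌊1+2n/2⌋ zero    = refl
  ⌊1+2n/2⌋ (suc n) =
    trans (cong (λ m → ⌊ 1 + m /2⌋) (double-suc n)) (cong suc (⌊1+2n/2⌋ n))

B-even : ∀ n → 1 ≤ n → B (2 * n) ≡ t· B n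
B-even (suc n) _ = begin
  B (2 * suc n)           ≡⟨ cong B (double-suc n) ⟩
  B (2 + 2 * n)           ≡⟨ unfold-even (2 * n) (parity-double n) ⟩
  t· B (1 + ⌊ 2 * n /2⌋)  ≡⟨ cong (λ m → t· B (1 + m)) (⌊2n/2⌋ n) ⟩
  t· B (suc n)            ∎
  where open ≡-Reasoning

B-odd : ∀ n → 1 ≤ n → B (2 * n + 1) ≡ B n ⊕ B (n + 1)
B-odd (suc n) _ = begin
  B (2 * suc n + 1)
    ≡⟨ cong B (trans (+-comm (2 * suc n) 1) (cong suc (double-suc n))) ⟩
  B (2 + (1 + 2 * n))
    ≡⟨ unfold-odd (1 + 2 * n) (parity-double+1 n) ⟩
  B (1 + ⌊ 1 + 2 * n /2⌋) ⊕ B (1 + ⌊ 2 + 2 * n /2⌋)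
    ≡⟨ cong₂ (λ i j → B (1 + i) ⊕ B (2 + j)) (⌊1+2n/2⌋ n) (⌊2n/2⌋ n) ⟩
  B (suc n) ⊕ B (2 + n)
    ≡⟨ cong (λ m → B (suc n) ⊕ B m) (+-comm 1 (suc n)) ⟩
  B (suc n) ⊕ B (suc n + 1) ∎
  where open ≡-Reasoning

-- For n ≥ 1 the coefficients of B n are nonnegative and not all zero, so the
-- default value is used only at n = 0.
e : ℕ → ℕ
e n = fromMaybe 0 (degree (B n))

ℰ : Pred ℕ 0ℓ
ℰ n = 1 ≤ n × e n ≡ e (n + 1)

Infinite : Pred ℕ 0ℓ → Set
Infinite P = ∀ N → ∃ λ n → N ≤ n × P n

{-# OPTIONS --safe #-}

-- The coefficients of B n are nonnegative, so no cancellation occurs and e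
-- satisfies e (2n) = e n + 1 and e (2n + 1) = e n ⊔ e (n + 1).  Call n a valley
-- of depth d if e n = e (n + 1) + d = e (n + 2).  A valley of depth d at 2k + 1
-- comes from one of depth d + 1 at k, whereas a valley at 2k forces d = 1 and
-- k ∈ ℰ.  Hence there are no valleys of depth at least 2 (infinite descent), and
-- a valley of depth 0 is at n = 2k + 1 with k = 2m and m ∈ ℰ.
module Submission where

open import Data.Empty using (⊥-elim)
open import Data.Integer.Base as ℤ using (0ℤ; +_)
open import Data.Integer.Properties using () renaming (_≟_ to _≟ℤ_)
open import Data.List.Base using ([]; _∷_)
open import Data.List.Relation.Unary.All using (All; []; _∷_)
open import Data.Maybe.Base using (Maybe; just; nothing; fromMaybe)
open import Data.Nat.Base
  using (ℕ; zero; suc; _+_; _*_; _≤_; _<_; _⊔_; ⌊_/2⌋; ⌈_/2⌉; parity; z≤n; s≤s)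
open import Data.Nat.Induction using (<-wellFounded)
open import Data.Nat.Properties
open import Data.Nat.Tactic.RingSolver using (solve-∀)
open import Data.Parity.Base using (0ℙ; 1ℙ)
open import Data.Product.Base using (_×_; _,_; ∃; proj₁; proj₂)
open import Data.Sum.Base using (inj₁; inj₂)
open import Induction.WellFounded using (Acc; acc)
open import Relation.Binary.PropositionalEquality
  using (_≡_; refl; sym; trans; cong; cong₂; subst; module ≡-Reasoning)
open import Relation.Nullary.Decidable.Core using (yes; no)
open import Relation.Nullary.Negation.Core using (¬_)
open import Relation.Unary using (_∈_)
open import Defs

-- Degrees under sums and multiplication by t.

NonNeg : Poly → Set
NonNeg = All (0ℤ ℤ.≤_)

infixl 6 _⊔?_

-- The zero polynomial has degree `nothing`, which acts as minus infinity and is neutral for the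
-- maximum.
_⊔?_ : Maybe ℕ → Maybe ℕ → Maybe ℕ
nothing ⊔? y       = y
just m  ⊔? nothing = just m
just m  ⊔? just n  = just (m ⊔ n)

⊔?-identityʳ : ∀ x → x ⊔? nothing ≡ x
⊔?-identityʳ nothing  = refl
⊔?-identityʳ (just _) = refl

⊕-nonNeg : ∀ {p q} → NonNeg p → NonNeg q → NonNeg (p ⊕ q)
⊕-nonNeg []              q≥0             = q≥0
⊕-nonNeg (a≥0 ∷ p≥0)     []              = a≥0 ∷ p≥0
⊕-nonNeg (ℤ.+≤+ _ ∷ p≥0) (ℤ.+≤+ _ ∷ q≥0) = ℤ.+≤+ z≤n ∷ ⊕-nonNeg p≥0 q≥0

-- Nonnegative leading coefficients cannot cancel. The signs matter only when both tails vanish and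
-- the sum of the constant terms decides.
degree-⊕ : ∀ {p q} → NonNeg p → NonNeg q → degree (p ⊕ q) ≡ degree p ⊔? degree q
degree-⊕ [] q≥0 = refl
degree-⊕ {p} (_ ∷ _) [] = sym (⊔?-identityʳ (degree p))
degree-⊕ {a ∷ p} {b ∷ q} (a≥0 ∷ p≥0) (b≥0 ∷ q≥0)
  with degree (p ⊕ q) | degree p | degree q | degree-⊕ p≥0 q≥0
... | _ | just _  | just _  | refl = refl
... | _ | just _  | nothing | refl with b ≟ℤ 0ℤ
...   | yes _ = refl
...   | no  _ = refl
degree-⊕ {a ∷ p} {b ∷ q} (a≥0 ∷ p≥0) (b≥0 ∷ q≥0)
    | _ | nothing | just _  | refl with a ≟ℤ 0ℤ
...   | yes _ = refl
...   | no  _ = refl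
degree-⊕ {+ zero  ∷ p} {+ zero  ∷ q} _ _ | _ | nothing | nothing | refl = refl
degree-⊕ {+ zero  ∷ p} {+ suc _ ∷ q} _ _ | _ | nothing | nothing | refl = refl
degree-⊕ {+ suc _ ∷ p} {+ zero  ∷ q} _ _ | _ | nothing | nothing | refl = refl
degree-⊕ {+ suc _ ∷ p} {+ suc _ ∷ q} _ _ | _ | nothing | nothing | refl = refl

degree-t· : ∀ {p d} → degree p ≡ just d → degree (t· p) ≡ just (suc d)
degree-t· {p} eq with degree p | eq
... | _ | refl = refl

NonNegNonZero : Poly → Set
NonNegNonZero p = NonNeg p × ∃ λ d → degree p ≡ just d

t·-nonNegNonZero : ∀ {p} → NonNegNonZero p → NonNegNonZero (t· p)
t·-nonNegNonZero {p} (p≥0 , d , eq) = ℤ.+≤+ z≤n ∷ p≥0 , suc d , degree-t· {p} eq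

degree-⊕-just : ∀ {p q c d} → NonNeg p → NonNeg q →
                degree p ≡ just c → degree q ≡ just d → degree (p ⊕ q) ≡ just (c ⊔ d)
degree-⊕-just p≥0 q≥0 eqp eqq = trans (degree-⊕ p≥0 q≥0) (cong₂ _⊔?_ eqp eqq)

⊕-nonNegNonZero : ∀ {p q} → NonNegNonZero p → NonNegNonZero q → NonNegNonZero (p ⊕ q)
⊕-nonNegNonZero (p≥0 , c , eqp) (q≥0 , d , eqq) =
  ⊕-nonNeg p≥0 q≥0 , c ⊔ d , degree-⊕-just p≥0 q≥0 eqp eqq

-- Recurrences for `e`.

B-acc-nonNegNonZero : ∀ n (a : Acc _<_ n) → 1 ≤ n → NonNegNonZero (B-acc n a)
B-acc-nonNegNonZero 1 _ _ = ℤ.+≤+ z≤n ∷ [] , 0 , refl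
B-acc-nonNegNonZero n@(suc (suc k)) (acc rs) _ with parity n
... | 0ℙ = t·-nonNegNonZero (B-acc-nonNegNonZero ⌊ n /2⌋ _ (s≤s z≤n))
... | 1ℙ = ⊕-nonNegNonZero (B-acc-nonNegNonZero ⌊ n /2⌋ _ (s≤s z≤n))
                           (B-acc-nonNegNonZero ⌈ n /2⌉ _ (s≤s z≤n))

B-nonNegNonZero : ∀ n → 1 ≤ n → NonNegNonZero (B n)
B-nonNegNonZero n = B-acc-nonNegNonZero n (<-wellFounded n)

degree-B : ∀ n → 1 ≤ n → degree (B n) ≡ just (e n)
degree-B n 1≤n with degree (B n) | proj₂ (B-nonNegNonZero n 1≤n)
... | _ | _ , refl = refl

e-double : ∀ k → 1 ≤ k → e (2 * k) ≡ suc (e k)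
e-double k 1≤k = cong (fromMaybe 0)
  (trans (cong degree (B-even k 1≤k)) (degree-t· {B k} (degree-B k 1≤k)))

e-double+1 : ∀ k → 1 ≤ k → e (2 * k + 1) ≡ e k ⊔ e (k + 1)
e-double+1 k 1≤k = cong (fromMaybe 0) (trans (cong degree (B-odd k 1≤k))
  (degree-⊕-just (proj₁ (B-nonNegNonZero k 1≤k)) (proj₁ (B-nonNegNonZero (k + 1) 1≤k+1))
                 (degree-B k 1≤k) (degree-B (k + 1) 1≤k+1)))
  where 1≤k+1 = m≤n+m 1 k

-- This form covers k = 0 as well, because the recurrence is applied at k + 1.
e-double+2 : ∀ k → e (2 * k + 2) ≡ suc (e (k + 1))
e-double+2 k = trans (cong e (sym (*-distribˡ-+ 2 k 1))) (e-double (k + 1) (m≤n+m 1 k))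

e-double+3 : ∀ k → e (2 * k + 3) ≡ e (k + 1) ⊔ e (k + 2)
e-double+3 k = begin
  e (2 * k + 3)              ≡⟨ cong e (2k+3 k) ⟩
  e (2 * (k + 1) + 1)        ≡⟨ e-double+1 (k + 1) (m≤n+m 1 k) ⟩
  e (k + 1) ⊔ e (k + 1 + 1)  ≡⟨ cong (λ i → e (k + 1) ⊔ e i) (+-assoc k 1 1) ⟩
  e (k + 1) ⊔ e (k + 2)      ∎
  where
  open ≡-Reasoning
  2k+3 : ∀ k → 2 * k + 3 ≡ 2 * (k + 1) + 1
  2k+3 = solve-∀

-- Valleys and their descent.

-- Depth 0 is allowed and means three equal consecutive values.
Valley : ℕ → ℕ → Set
Valley d n = e n ≡ e (n + 1) + d × e (n + 2) ≡ e (n + 1) + d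

data Halving : ℕ → Set where
  double   : ∀ k → Halving (2 * k)
  double+1 : ∀ k → Halving (2 * k + 1)

halving : ∀ n → Halving n
halving zero = double 0
halving (suc n) with halving n
... | double k   = subst Halving (+-comm (2 * k) 1) (double+1 k)
... | double+1 k = subst Halving (2[k+1] k) (double (k + 1))
  where
  2[k+1] : ∀ k → 2 * (k + 1) ≡ suc (2 * k + 1)
  2[k+1] = solve-∀

1≤2k⇒1≤k : ∀ k → 1 ≤ 2 * k → 1 ≤ k
1≤2k⇒1≤k (suc _) _ = s≤s z≤n

k<2k+1 : ∀ k → k < 2 * k + 1
k<2k+1 k = subst (k <_) (+-comm 1 (2 * k)) (s≤s (m≤m+n k _))

-- The maximum exceeds `n`, so it is attained at `m`.
⊔≡+suc⇒≡ˡ : ∀ m n d → m ⊔ n ≡ suc n + d → m ≡ n + suc d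
⊔≡+suc⇒≡ˡ m n d eq with ⊔-sel m n
... | inj₁ m⊔n≡m = trans (trans (sym m⊔n≡m) eq) (sym (+-suc n d))
... | inj₂ m⊔n≡n = ⊥-elim (m≢1+m+n n (trans (sym m⊔n≡n) eq))

-- The outer values are e k + 1 and e (k + 1) + 1, so e k = e (k + 1). The middle one is then e k,
-- exactly one lower.
valley-double : ∀ {d} k → 1 ≤ k → Valley d (2 * k) → k ∈ ℰ × d ≡ 1
valley-double {d} k 1≤k (l , r) = (1≤k , ek≡ek+1) , sym (+-cancelˡ-≡ (e k) 1 d ek+1≡ek+d)
  where
  open ≡-Reasoning
  ek≡ek+1 : e k ≡ e (k + 1)
  ek≡ek+1 = suc-injective (begin
    suc (e k)        ≡⟨ e-double k 1≤k ⟨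
    e (2 * k)        ≡⟨ trans l (sym r) ⟩
    e (2 * k + 2)    ≡⟨ e-double+2 k ⟩
    suc (e (k + 1))  ∎)
  ek+1≡ek+d : e k + 1 ≡ e k + d
  ek+1≡ek+d = begin
    e k + 1                ≡⟨ +-comm (e k) 1 ⟩
    suc (e k)              ≡⟨ e-double k 1≤k ⟨
    e (2 * k)              ≡⟨ l ⟩
    e (2 * k + 1) + d      ≡⟨ cong (_+ d) (e-double+1 k 1≤k) ⟩
    e k ⊔ e (k + 1) + d    ≡⟨ cong (λ i → e k ⊔ i + d) ek≡ek+1 ⟨
    e k ⊔ e k + d          ≡⟨ cong (_+ d) (⊔-idem (e k)) ⟩
    e k + d                ∎

-- The middle value is e (k + 1) + 1, and the outer ones are the maxima of e (k + 1) with e k and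
-- with e (k + 2). They exceed e (k + 1), so e k and e (k + 2) attain them.
valley-double+1 : ∀ {d} k → Valley d (2 * k + 1) → 1 ≤ k × Valley (suc d) k
-- Here e 1 = 0 and e 2 = 1, so 0 = 1 + d.
valley-double+1 zero (() , _)
valley-double+1 {d} k@(suc _) (l , r) =
    s≤s z≤n
  , ⊔≡+suc⇒≡ˡ (e k) (e (k + 1)) d (begin
      e k ⊔ e (k + 1)          ≡⟨ e-double+1 k (s≤s z≤n) ⟨
      e (2 * k + 1)            ≡⟨ l ⟩
      e (2 * k + 1 + 1) + d    ≡⟨ bottom ⟩
      suc (e (k + 1)) + d      ∎)
  , ⊔≡+suc⇒≡ˡ (e (k + 2)) (e (k + 1)) d (begin
      e (k + 2) ⊔ e (k + 1)    ≡⟨ ⊔-comm (e (k + 2)) (e (k + 1)) ⟩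
      e (k + 1) ⊔ e (k + 2)    ≡⟨ e-double+3 k ⟨
      e (2 * k + 3)            ≡⟨ cong e (+-assoc (2 * k) 1 2) ⟨
      e (2 * k + 1 + 2)        ≡⟨ r ⟩
      e (2 * k + 1 + 1) + d    ≡⟨ bottom ⟩
      suc (e (k + 1)) + d      ∎)
  where
  open ≡-Reasoning
  bottom : e (2 * k + 1 + 1) + d ≡ suc (e (k + 1)) + d
  bottom = cong (_+ d) (trans (cong e (+-assoc (2 * k) 1 1)) (e-double+2 k))

-- Each halving raises the depth by one, so `d` varies in the induction. An even position would need
-- depth 1.
no-deep-valley : ∀ {d} n → Acc _<_ n → 1 ≤ n → ¬ Valley (2 + d) n
no-deep-valley n (acc rs) 1≤n v with halving n
... | double k with () ← proj₂ (valley-double k (1≤2k⇒1≤k k 1≤n) v)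
... | double+1 k =
  let 1≤k , v′ = valley-double+1 k v in no-deep-valley k (rs (k<2k+1 k)) 1≤k v′

-- Runs of equal values.

flat⇒4m+1 : ∀ n → 1 ≤ n → e n ≡ e (n + 1) → e (n + 1) ≡ e (n + 2) →
            ∃ λ m → m ∈ ℰ × n ≡ 4 * m + 1
flat⇒4m+1 n 1≤n e₀≡e₁ e₁≡e₂ = go (halving n) 1≤n
  (trans e₀≡e₁ (sym (+-identityʳ _)) , trans (sym e₁≡e₂) (sym (+-identityʳ _)))
  where
  go : ∀ {n} → Halving n → 1 ≤ n → Valley 0 n → ∃ λ m → m ∈ ℰ × n ≡ 4 * m + 1
  go (double k) 1≤2k v with () ← proj₂ (valley-double k (1≤2k⇒1≤k k 1≤2k) v)
  go (double+1 k) _ v with valley-double+1 k v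
  ... | 1≤k , v′ with halving k
  ...   | double m = m , proj₁ (valley-double m (1≤2k⇒1≤k m 1≤k) v′) ,
                     cong (_+ 1) (sym (*-assoc 2 2 m))
  ...   | double+1 j =
    -- Two odd halvings turn depth 0 at n into depth 2 at `j`.
    let 1≤j , v″ = valley-double+1 j v′ in ⊥-elim (no-deep-valley j (<-wellFounded j) 1≤j v″)

-- At 2m, 2m + 1, 2m + 2 the values are e m + 1, e m, e m + 1, so one further doubling gives e m + 1
-- at all three places.
ℰ⇒flat : ∀ m → m ∈ ℰ →
         e (4 * m + 1) ≡ e (4 * m + 1 + 1) × e (4 * m + 1 + 1) ≡ e (4 * m + 1 + 2)
ℰ⇒flat m (1≤m , em≡em+1) = trans e₁ (sym e₂) , trans e₂ (sym e₃)
  where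
  open ≡-Reasoning
  4m≡2[2m] : 4 * m ≡ 2 * (2 * m)
  4m≡2[2m] = *-assoc 2 2 m
  e[2m+1] : e (2 * m + 1) ≡ e m
  e[2m+1] = begin
    e (2 * m + 1)    ≡⟨ e-double+1 m 1≤m ⟩
    e m ⊔ e (m + 1)  ≡⟨ cong (e m ⊔_) em≡em+1 ⟨
    e m ⊔ e m        ≡⟨ ⊔-idem (e m) ⟩
    e m              ∎
  e₁ : e (4 * m + 1) ≡ suc (e m)
  e₁ = begin
    e (4 * m + 1)              ≡⟨ cong (λ i → e (i + 1)) 4m≡2[2m] ⟩
    e (2 * (2 * m) + 1)        ≡⟨ e-double+1 (2 * m) (≤-trans 1≤m (m≤n*m m 2)) ⟩
    e (2 * m) ⊔ e (2 * m + 1)  ≡⟨ cong₂ _⊔_ (e-double m 1≤m) e[2m+1] ⟩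
    suc (e m) ⊔ e m            ≡⟨ m≥n⇒m⊔n≡m (n≤1+n (e m)) ⟩
    suc (e m)                  ∎
  e₂ : e (4 * m + 1 + 1) ≡ suc (e m)
  e₂ = begin
    e (4 * m + 1 + 1)          ≡⟨ cong e (+-assoc (4 * m) 1 1) ⟩
    e (4 * m + 2)              ≡⟨ cong (λ i → e (i + 2)) 4m≡2[2m] ⟩
    e (2 * (2 * m) + 2)        ≡⟨ e-double+2 (2 * m) ⟩
    suc (e (2 * m + 1))        ≡⟨ cong suc e[2m+1] ⟩
    suc (e m)                  ∎
  e₃ : e (4 * m + 1 + 2) ≡ suc (e m)
  e₃ = begin
    e (4 * m + 1 + 2)              ≡⟨ cong e (+-assoc (4 * m) 1 2) ⟩
    e (4 * m + 3)                  ≡⟨ cong (λ i → e (i + 3)) 4m≡2[2m] ⟩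
    e (2 * (2 * m) + 3)            ≡⟨ e-double+3 (2 * m) ⟩
    e (2 * m + 1) ⊔ e (2 * m + 2)  ≡⟨ cong₂ _⊔_ e[2m+1] (e-double+2 m) ⟩
    e m ⊔ suc (e (m + 1))          ≡⟨ cong (λ i → e m ⊔ suc i) em≡em+1 ⟨
    e m ⊔ suc (e m)                ≡⟨ m≤n⇒m⊔n≡n (n≤1+n (e m)) ⟩
    suc (e m)                      ∎

4m+1∈ℰ : ∀ m → m ∈ ℰ → 4 * m + 1 ∈ ℰ
4m+1∈ℰ m m∈ℰ = m≤n+m 1 (4 * m) , proj₁ (ℰ⇒flat m m∈ℰ)

ℰ-infinite : Infinite ℰ
-- The seed is 2, as e 2 = e 3 = 1; iterating the map from m to 4m + 1 raises the bound by at least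
-- one each time.
ℰ-infinite zero    = 2 , z≤n , s≤s z≤n , refl
ℰ-infinite (suc N) =
  let m , N≤m , m∈ℰ = ℰ-infinite N
  in 4 * m + 1 , subst (suc N ≤_) (+-comm 1 (4 * m)) (s≤s (≤-trans N≤m (m≤n*m m 4))) ,
     4m+1∈ℰ m m∈ℰ

4m+2≢4l+1 : ∀ m l → ¬ 4 * m + 1 + 1 ≡ 4 * l + 1
4m+2≢4l+1 m l eq = even≢odd (2 * l) (2 * m) (begin
  2 * (2 * l)        ≡⟨ *-assoc 2 2 l ⟨
  4 * l              ≡⟨ +-cancelʳ-≡ 1 _ _ eq ⟨
  4 * m + 1          ≡⟨ +-comm (4 * m) 1 ⟩
  suc (4 * m)        ≡⟨ cong suc (*-assoc 2 2 m) ⟩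
  suc (2 * (2 * m))  ∎)
  where open ≡-Reasoning

theorem4p6 : ( Infinite ℰ
    × (∀ m → m ∈ ℰ → e (4 * m + 1) ≡ e (4 * m + 1 + 1) × e (4 * m + 1 + 1) ≡ e (4 * m + 1 + 2))
    × (∀ n → 1 ≤ n → e n ≡ e (n + 1) → e (n + 1) ≡ e (n + 2) → ∃ λ m → m ∈ ℰ × n ≡ 4 * m + 1) )
    × ¬ (∃ λ n → 1 ≤ n × e n ≡ e (n + 1) × e (n + 1) ≡ e (n + 2) × e (n + 2) ≡ e (n + 3))
theorem4p6 = (ℰ-infinite , ℰ⇒flat , flat⇒4m+1) , no-four
  where
  no-four : ¬ (∃ λ n → 1 ≤ n × e n ≡ e (n + 1) × e (n + 1) ≡ e (n + 2) × e (n + 2) ≡ e (n + 3))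
  no-four (n , 1≤n , e₀≡e₁ , e₁≡e₂ , e₂≡e₃) =
    -- Four equal values contain two overlapping triples, so n and n + 1 would both be 1 modulo 4.
    let m , _ , n≡4m+1   = flat⇒4m+1 n 1≤n e₀≡e₁ e₁≡e₂
        l , _ , n+1≡4l+1 = flat⇒4m+1 (n + 1) (m≤n+m 1 n)
          (trans e₁≡e₂ (cong e (sym (+-assoc n 1 1))))
          (trans (cong e (+-assoc n 1 1)) (trans e₂≡e₃ (cong e (sym (+-assoc n 1 2)))))
    in 4m+2≢4l+1 m l (trans (cong (_+ 1) (sym n≡4m+1)) n+1≡4l+1)
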